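{- Let $\mathcal{G}=(V,E,\lambda)$ be a happy compressed temporal graph with $n=|V|>2$ vertices. If $\mathcal{G}$ is acyclic and temporally connected, then $\mathcal{G}$ is not pivotable, i.e. it has no pivot edge.
   Context: A happy temporal graph is a triple $\mathcal{G}=(V,E,\lambda)$ where $(V,E)$ is a finite simple undirected graph (the footprint) and $\lambda:E\to\{1,2,3,\dots\}$ assigns a single time label to each edge, such that two distinct edges sharing an endpoint have different labels. It is compressed if for every edge $e$ with $\lambda(e)>1$ there is an edge $e'$ adjacent to $e$ with $\lambda(e')=\lambda(e)-1$. A temporal walk is a walk in the footprint along which edge labels are strictly increasing (so no edge is repeated). For a vertex $v$ and an edge $e$: $v\leadsto e$ means some temporal walk starts at $v$ and traverses $e$; $e\leadsto v$ means some temporal walk traverses $e$ and ends at $v$ (edges may be traversed in either direction). $\mathcal{G}$ is temporally connected if for all distinct $u,v\in V$ there is a temporal walk from $u$ to $v$. A temporal cycle is a nonempty temporal walk from a vertex to itself; $\mathcal{G}$ is acyclic if it has no temporal cycle. A pivot edge is an edge $e$ such that $v\leadsto e$ and $e\leadsto v$ for all $v\in V$; $\mathcal{G}$ is pivotable if it has a pivot edge. -}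

module Defs where

open import Data.Fin.Base as Fin using (Fin)
open import Data.List.Base using (List; []; _∷_; map)
open import Data.List.Membership.Propositional using (_∈_)
open import Data.List.Relation.Unary.Linked using (Linked)
open import Data.Nat.Base using (ℕ; _∸_; _≤_; _<_)
open import Data.Product.Base using (Σ-syntax; ∃-syntax; _×_)
open import Data.Sum.Base using (_⊎_)
open import Relation.Binary.PropositionalEquality.Core using (_≡_; _≢_)
open import Relation.Nullary.Negation.Core using (¬_)

-- The vertex set is Fin n.  The edge set is enumerated without repetition by
-- Fin m; the unordered pair of endpoints of an edge is stored once, smaller
-- endpoint first, so lo<hi excludes loops and simple excludes parallel edges.
record SimpleGraph (n : ℕ) : Set where
  field
    m      : ℕ
    lo hi  : Fin m → Fin n
    lo<hi  : ∀ e → lo e Fin.< hi e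
    simple : ∀ {e f} → lo e ≡ lo f → hi e ≡ hi f → e ≡ f

  Vertex : Set
  Vertex = Fin n

  Edge : Set
  Edge = Fin m

  _isEndpointOf_ : Vertex → Edge → Set
  v isEndpointOf e = v ≡ lo e ⊎ v ≡ hi e

  Adjacent : Edge → Edge → Set
  Adjacent e f = e ≢ f × ∃[ v ] (v isEndpointOf e × v isEndpointOf f)

  -- e can be traversed from u to v; either direction is allowed.
  Joins : Edge → Vertex → Vertex → Set
  Joins e u v = (u ≡ lo e × v ≡ hi e) ⊎ (u ≡ hi e × v ≡ lo e)

  data Walk : Vertex → Vertex → Set where
    stop : ∀ {v} → Walk v v
    step : ∀ {u v w} (e : Edge) → Joins e u v → Walk v w → Walk u w

  edges : ∀ {u v} → Walk u v → List Edge
  edges stop         = []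
  edges (step e _ p) = e ∷ edges p

record HappyTemporalGraph (n : ℕ) : Set where
  field
    footprint : SimpleGraph n
  open SimpleGraph footprint public
  field
    label     : Edge → ℕ
    label-pos : ∀ e → 1 ≤ label e
    happy     : ∀ {e f} → Adjacent e f → label e ≢ label f

module _ {n : ℕ} (G : HappyTemporalGraph n) where
  open HappyTemporalGraph G

  Compressed : Set
  Compressed = ∀ e → 1 < label e → ∃[ e′ ] (Adjacent e e′ × label e′ ≡ label e ∸ 1)

  -- Labels increase strictly between consecutive edges.
  IsTemporal : ∀ {u v} → Walk u v → Set
  IsTemporal p = Linked _<_ (map label (edges p))

  TemporallyConnected : Set
  TemporallyConnected = ∀ u v → u ≢ v → Σ[ p ∈ Walk u v ] IsTemporal p

  VertexReachesEdge : Vertex → Edge → Set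
  VertexReachesEdge v e = ∃[ w ] Σ[ p ∈ Walk v w ] (IsTemporal p × e ∈ edges p)

  EdgeReachesVertex : Edge → Vertex → Set
  EdgeReachesVertex e v = ∃[ u ] Σ[ p ∈ Walk u v ] (IsTemporal p × e ∈ edges p)

  TemporalCycle : Set
  TemporalCycle = ∃[ v ] Σ[ p ∈ Walk v v ] (IsTemporal p × edges p ≢ [])

  Acyclic : Set
  Acyclic = ¬ TemporalCycle

  IsPivot : Edge → Set
  IsPivot e = ∀ v → VertexReachesEdge v e × EdgeReachesVertex e v

  Pivotable : Set
  Pivotable = ∃[ e ] IsPivot e

{-# OPTIONS --safe #-}
module Submission where

open import Defs
open import Data.Fin.Base using (Fin; zero; punchIn; punchOut)
open import Data.Fin.Properties using (<⇒≢; punchInᵢ≢i; punchIn-injective; punchIn-punchOut)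
open import Data.List.Base using (List; []; _∷_; _++_; map)
open import Data.List.Membership.Propositional using (_∈_)
open import Data.List.Properties using (map-++; ++-conicalˡ; ++-conicalʳ)
open import Data.List.Relation.Unary.Any using (here; there)
open import Data.List.Relation.Unary.Linked using (Linked; []; [-]; _∷_)
open import Data.Nat.Base using (ℕ; _<_; _>_; s≤s)
open import Data.Nat.Properties using (<-trans)
open import Data.Product.Base using (Σ-syntax; ∃-syntax; _×_; _,_)
open import Data.Sum.Base using (_⊎_; inj₁; inj₂)
open import Level using (Level)
open import Relation.Binary.Core using (Rel)
open import Relation.Binary.Definitions using (Transitive)
open import Relation.Binary.PropositionalEquality
  using (_≡_; _≢_; refl; sym; trans; cong; subst)
open import Relation.Nullary.Negation.Core using (¬_)

-- Let e be a pivot edge with label t, and v a vertex that is not an endpoint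
-- of e.  Some temporal walk leads from v to an endpoint x of e with labels
-- below t, and another leads from an endpoint y of e back to v with labels
-- above t.  Their concatenation, with e inserted if x ≠ y, is a temporal cycle
-- through v.

private variable
  a ℓ : Level
  A   : Set a
  R   : Rel A ℓ
  n   : ℕ

Linked-++⁻ʳ : ∀ (xs : List A) {ys} → Linked R (xs ++ ys) → Linked R ys
Linked-++⁻ʳ []           l       = l
Linked-++⁻ʳ (x ∷ [])     [-]     = []
Linked-++⁻ʳ (x ∷ [])     (_ ∷ l) = l
Linked-++⁻ʳ (x ∷ y ∷ xs) (_ ∷ l) = Linked-++⁻ʳ (y ∷ xs) l

-- Being linked only constrains neighbours, so the part after `y` can be exchanged freely. With `y`
-- the label of the pivot edge, this glues the start of one walk to the end of another.
Linked-splice : ∀ (xs : List A) {y ys zs} →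
                Linked R (xs ++ y ∷ ys) → Linked R (y ∷ zs) → Linked R (xs ++ y ∷ zs)
Linked-splice []            _       l = l
Linked-splice (x ∷ [])      (r ∷ _) l = r ∷ l
Linked-splice (x ∷ x′ ∷ xs) (r ∷ k) l = r ∷ Linked-splice (x′ ∷ xs) k l

-- Transitivity bridges the gap left by `y`. This serves the case where the two walks already meet
-- at one endpoint of the pivot edge, so that the edge itself is skipped.
Linked-delete : Transitive R → ∀ (xs : List A) {y ys} →
                Linked R (xs ++ y ∷ ys) → Linked R (xs ++ ys)
Linked-delete tr []            l                = Linked-++⁻ʳ (_ ∷ []) l
Linked-delete tr (x ∷ [])      (_ ∷ [-])        = [-]
Linked-delete tr (x ∷ [])      (r ∷ (r′ ∷ l))   = tr r r′ ∷ l
Linked-delete tr (x ∷ x′ ∷ xs) (r ∷ l)          = r ∷ Linked-delete tr (x′ ∷ xs) l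

∃-avoiding-two : n > 2 → {i j : Fin n} → i ≢ j → ∃[ k ] (k ≢ i × k ≢ j)
∃-avoiding-two (s≤s (s≤s (s≤s _))) {i} {j} i≢j =
  -- `punchIn i` embeds a set with one element fewer into the complement of `i`, and `j′` is the
  -- preimage of `j` there. It remains to avoid `j′`, which `n > 2` leaves room for.
  punchIn i (punchIn j′ zero) , punchInᵢ≢i i _ , λ eq →
    punchInᵢ≢i j′ zero
      (punchIn-injective i _ _ (trans eq (sym (punchIn-punchOut i≢j))))
  where j′ = punchOut i≢j

module _ (S : SimpleGraph n) where
  open SimpleGraph S

  infixr 5 _++ʷ_
  _++ʷ_ : ∀ {u v w} → Walk u v → Walk v w → Walk u w
  stop       ++ʷ q = q
  step e j p ++ʷ q = step e j (p ++ʷ q)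

  edges-++ʷ : ∀ {u v w} (p : Walk u v) (q : Walk v w) →
              edges (p ++ʷ q) ≡ edges p ++ edges q
  edges-++ʷ stop         q = refl
  edges-++ʷ (step e j p) q = cong (e ∷_) (edges-++ʷ p q)

  edges≡[]⇒≡ : ∀ {u v} (p : Walk u v) → edges p ≡ [] → u ≡ v
  edges≡[]⇒≡ stop _ = refl

  split-at : ∀ {u w e} (p : Walk u w) → e ∈ edges p →
             ∃[ x ] ∃[ y ] Joins e x y × Σ[ q ∈ Walk u x ] Σ[ r ∈ Walk y w ]
               edges p ≡ edges q ++ e ∷ edges r
  split-at (step e j p) (here refl) = _ , _ , j , stop , p , refl
  split-at (step f j p) (there e∈p) with split-at p e∈p
  ... | x , y , k , q , r , eq = x , y , k , step f j q , r , cong (f ∷_) eq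

  joins⇒endpoint : ∀ {e u v} → Joins e u v → u isEndpointOf e
  joins⇒endpoint (inj₁ (u≡lo , _)) = inj₁ u≡lo
  joins⇒endpoint (inj₂ (u≡hi , _)) = inj₂ u≡hi

  -- Two traversals of one edge have either the same or opposite directions; this decides whether
  -- the closing walk must use the edge.
  joins-target : ∀ {e u v u′ v′} → Joins e u v → Joins e u′ v′ → v′ ≡ v ⊎ v′ ≡ u
  joins-target (inj₁ (_    , refl)) (inj₁ (_ , refl)) = inj₁ refl
  joins-target (inj₁ (refl , _))    (inj₂ (_ , refl)) = inj₂ refl
  joins-target (inj₂ (refl , _))    (inj₁ (_ , refl)) = inj₂ refl
  joins-target (inj₂ (_    , refl)) (inj₂ (_ , refl)) = inj₁ refl

module _ (G : HappyTemporalGraph n) where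
  open HappyTemporalGraph G

  map-label-++⁺ : ∀ {es} fs gs → es ≡ fs ++ gs →
                  Linked _<_ (map label fs ++ map label gs) → Linked _<_ (map label es)
  map-label-++⁺ fs gs refl = subst (Linked _<_) (sym (map-++ label fs gs))

  map-label-++⁻ : ∀ {es} fs gs → es ≡ fs ++ gs →
                  Linked _<_ (map label es) → Linked _<_ (map label fs ++ map label gs)
  map-label-++⁻ fs gs refl = subst (Linked _<_) (map-++ label fs gs)

  reach-both⇒cycle : ∀ {e v} → ¬ v isEndpointOf e →
                     VertexReachesEdge G v e → EdgeReachesVertex G e v → TemporalCycle G
  reach-both⇒cycle {e} {v} v∉e (_ , p , tp , e∈p) (_ , p′ , tp′ , e∈p′)
    with split-at footprint p e∈p | split-at footprint p′ e∈p′
  ... | x , y , j , q , s , eq | x′ , y′ , j′ , s′ , r , eq′ =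
    close (joins-target footprint j j′) r through-e
    where
    -- This is a statement about labels alone: it holds even if `e` is traversed in opposite
    -- directions by the two walks, when no walk need have this sequence of edges.
    through-e : Linked _<_ (map label (edges q) ++ label e ∷ map label (edges r))
    through-e = Linked-splice (map label (edges q))
      (map-label-++⁻ (edges q) (e ∷ edges s) eq tp)
      (Linked-++⁻ʳ (map label (edges s′)) (map-label-++⁻ (edges s′) (e ∷ edges r) eq′ tp′))

    -- The return walk is abstracted over its start `z`, so that matching on `refl` can identify `z`
    -- with an endpoint of `e`.
    close : ∀ {z} → z ≡ y ⊎ z ≡ x → (r : Walk z v) →
            Linked _<_ (map label (edges q) ++ label e ∷ map label (edges r)) →
            TemporalCycle G
    close (inj₁ refl) r l =
      v , _++ʷ_ footprint q er , map-label-++⁺ (edges q) (edges er) split l ,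
      λ empty → case-∷ (++-conicalʳ (edges q) _ (trans (sym split) empty))
      where
      er = step e j r
      split = edges-++ʷ footprint q er
      case-∷ : e ∷ edges r ≢ []
      case-∷ ()
    -- The return walk starts at `x`, where `q` ends, so `e` is left out. If nothing remained, `q`
    -- would be empty and `v` would equal `x`, an endpoint of `e`.
    close (inj₂ refl) r l =
      v , _++ʷ_ footprint q r ,
      map-label-++⁺ (edges q) (edges r) split (Linked-delete <-trans (map label (edges q)) l) ,
      λ empty → v∉e (subst (_isEndpointOf e)
        (sym (edges≡[]⇒≡ footprint q (++-conicalˡ _ _ (trans (sym split) empty))))
        (joins⇒endpoint footprint j))
      where split = edges-++ʷ footprint q r

lemma3p28 : (n : ℕ) → n > 2 → (G : HappyTemporalGraph n) → Compressed G →
    Acyclic G → TemporallyConnected G → ¬ Pivotable G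
lemma3p28 n n>2 G _ acyclic _ (e , pivot)
  with ∃-avoiding-two n>2 (<⇒≢ (HappyTemporalGraph.lo<hi G e))
... | v , v≢lo , v≢hi with pivot v
... | v⇝e , e⇝v =
  acyclic (reach-both⇒cycle G (λ { (inj₁ eq) → v≢lo eq ; (inj₂ eq) → v≢hi eq }) v⇝e e⇝v)
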